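{- There is a sequence $\vec{R} = \langle R_i : i \in \omega\rangle$ of subsets of $\omega$ such that for every natural number $m$ and every partition $A_0,\ldots,A_{m-1}$ of $\omega$ that is arithmetical in $\vec{R}$, there is some $j<m$ and an infinite set $S \subseteq A_j$ such that $S$ computes no $\vec{R}$-cohesive set.
   Context: For a sequence $\vec{R} = \langle R_i : i\in\omega \rangle$ of subsets of $\omega$, a set $S \subseteq \omega$ is called $\vec{R}$-cohesive if $S$ is infinite and for every $i$, either $S \cap R_i$ is finite or $S \cap \overline{R_i}$ is finite. A set is arithmetical in $\vec{R}$ if it is definable by a first-order arithmetic formula with (a set coding) $\vec{R}$ as a parameter, equivalently if it is computable from some finite Turing jump of $\vec{R}$. "Computes" means Turing-computes. -}

module Defs where

open import Level using (0ℓ)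
open import Data.Nat using (ℕ; zero; suc; _+_; _*_; _<_; _≤_)
open import Data.Bool using (Bool; true; false; if_then_else_)
open import Data.Fin using (Fin)
open import Data.Vec using (Vec; []; _∷_; lookup)
open import Data.Product using (Σ; _×_; _,_; ∃)
open import Data.Sum using (_⊎_)
open import Data.Empty using (⊥)
open import Relation.Nullary using (¬_)
open import Relation.Binary.PropositionalEquality using (_≡_)
open import Function.Bundles using (_⇔_)

Subset : Set
Subset = ℕ → Bool

SetSeq : Set
SetSeq = ℕ → Subset

complement : Subset → Subset
complement X n = if X n then false else true

_∩_ : Subset → Subset → Subset
(X ∩ Y) n = if X n then Y n else false

_⊆_ : Subset → Subset → Set
X ⊆ Y = ∀ n → X n ≡ true → Y n ≡ true

Infinite : Subset → Set
Infinite X = ∀ k → Σ ℕ λ n → k ≤ n × X n ≡ true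

Finite : Subset → Set
Finite X = Σ ℕ λ b → ∀ n → X n ≡ true → n < b

Cohesive : SetSeq → Subset → Set
Cohesive R S = Infinite S × (∀ i → Finite (S ∩ R i) ⊎ Finite (S ∩ complement (R i)))

-- Oracle (relative) partial recursive functions, i.e. Turing computability
-- relative to an oracle X ⊆ ω.

data Code : ℕ → Set where
  zer    : ∀ {n} → Code n
  succ   : Code 1
  proj   : ∀ {n} → Fin n → Code n
  oracle : Code 1
  comp   : ∀ {k n} → Code k → Vec (Code n) k → Code n
  prec   : ∀ {n} → Code n → Code (suc (suc n)) → Code (suc n)
  mu     : ∀ {n} → Code (suc n) → Code n

χ : Subset → ℕ → ℕ
χ X x = if X x then 1 else 0

mutual
  data Eval (X : Subset) : ∀ {n} → Code n → Vec ℕ n → ℕ → Set where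
    ev-zer    : ∀ {n} {xs : Vec ℕ n} → Eval X zer xs 0
    ev-succ   : ∀ {x} → Eval X succ (x ∷ []) (suc x)
    ev-proj   : ∀ {n} {i : Fin n} {xs} → Eval X (proj i) xs (lookup xs i)
    ev-oracle : ∀ {x} → Eval X oracle (x ∷ []) (χ X x)
    ev-comp   : ∀ {k n} {f : Code k} {gs : Vec (Code n) k} {xs ys y} →
                EvalAll X gs xs ys → Eval X f ys y → Eval X (comp f gs) xs y
    ev-prec-z : ∀ {n} {f : Code n} {g : Code (suc (suc n))} {xs y} →
                Eval X f xs y → Eval X (prec f g) (0 ∷ xs) y
    ev-prec-s : ∀ {n} {f : Code n} {g : Code (suc (suc n))} {xs k r y} →
                Eval X (prec f g) (k ∷ xs) r → Eval X g (k ∷ r ∷ xs) y →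
                Eval X (prec f g) (suc k ∷ xs) y
    ev-mu     : ∀ {n} {f : Code (suc n)} {xs y} →
                Eval X f (y ∷ xs) 0 →
                (∀ z → z < y → Σ ℕ λ v → Eval X f (z ∷ xs) (suc v)) →
                Eval X (mu f) xs y

  data EvalAll (X : Subset) : ∀ {k n} → Vec (Code n) k → Vec ℕ n → Vec ℕ k → Set where
    []  : ∀ {n} {xs : Vec ℕ n} → EvalAll X [] xs []
    _∷_ : ∀ {k n} {g : Code n} {gs : Vec (Code n) k} {xs y ys} →
          Eval X g xs y → EvalAll X gs xs ys → EvalAll X (g ∷ gs) xs (y ∷ ys)

Computes : Subset → Subset → Set
Computes X Y = Σ (Code 1) λ e → ∀ n → Eval X e (n ∷ []) (χ Y n)

-- First-order arithmetic with a binary predicate symbol for the parameter R⃗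
-- (R(t,s) means s ∈ R_t). Variables are de Bruijn indices.

data Term : Set where
  var  : ℕ → Term
  `0   : Term
  `S   : Term → Term
  _`+_ : Term → Term → Term
  _`*_ : Term → Term → Term

data Formula : Set where
  _`=_  : Term → Term → Formula
  `R    : Term → Term → Formula
  `¬_   : Formula → Formula
  _`∧_  : Formula → Formula → Formula
  _`∨_  : Formula → Formula → Formula
  _`⇒_  : Formula → Formula → Formula
  `∀    : Formula → Formula
  `∃    : Formula → Formula

Env : Set
Env = ℕ → ℕ

_∷ₑ_ : ℕ → Env → Env
(x ∷ₑ ρ) zero    = x
(x ∷ₑ ρ) (suc i) = ρ i

⟦_⟧ₜ : Term → Env → ℕ
⟦ var i ⟧ₜ ρ   = ρ i
⟦ `0 ⟧ₜ ρ      = 0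
⟦ `S t ⟧ₜ ρ    = suc (⟦ t ⟧ₜ ρ)
⟦ t `+ s ⟧ₜ ρ  = ⟦ t ⟧ₜ ρ + ⟦ s ⟧ₜ ρ
⟦ t `* s ⟧ₜ ρ  = ⟦ t ⟧ₜ ρ * ⟦ s ⟧ₜ ρ

Sat : SetSeq → Env → Formula → Set
Sat R ρ (t `= s)  = ⟦ t ⟧ₜ ρ ≡ ⟦ s ⟧ₜ ρ
Sat R ρ (`R t s)  = R (⟦ t ⟧ₜ ρ) (⟦ s ⟧ₜ ρ) ≡ true
Sat R ρ (`¬ φ)    = ¬ Sat R ρ φ
Sat R ρ (φ `∧ ψ)  = Sat R ρ φ × Sat R ρ ψ
Sat R ρ (φ `∨ ψ)  = Sat R ρ φ ⊎ Sat R ρ ψ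
Sat R ρ (φ `⇒ ψ)  = Sat R ρ φ → Sat R ρ ψ
Sat R ρ (`∀ φ)    = ∀ x → Sat R (x ∷ₑ ρ) φ
Sat R ρ (`∃ φ)    = Σ ℕ λ x → Sat R (x ∷ₑ ρ) φ

ρ₀ : Env
ρ₀ _ = 0

Arithmetical : SetSeq → Subset → Set
Arithmetical R A = Σ Formula λ φ → ∀ n → (A n ≡ true) ⇔ Sat R (n ∷ₑ ρ₀) φ

IsPartition : ∀ {m} → (Fin m → Subset) → Set
IsPartition {m} A = ∀ n → Σ (Fin m) λ j → A j n ≡ true × (∀ k → A k n ≡ true → k ≡ j)

{-# OPTIONS --safe #-}
-- Take G : ℕ → ℕ Cohen generic over a countable family of sets, and let R_i be the fibre
-- G⁻¹(i).  Suppose arithmetical sets B_0, …, B_{k-1} cover an infinite named set X; after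
-- thinning X and dropping colours, every B_j meets every named infinite subset of X infinitely
-- often.  Build S_j ⊆ B_j simultaneously by Mathias forcing with named reservoirs.  Given
-- functionals Φ_j and a value i (Seetapun's dichotomy): either some k-colouring of the reservoir
-- has no finite monochromatic set that makes its Φ_j accept a large x, and shrinking the reservoir
-- to an infinite colour class keeps Φ_j(S_j) finite; or, by compactness, finitely many candidates x
-- suffice for all colourings.  In the latter case a condition can send all these x to i before
-- the colouring by the B_j is decided, so by genericity some Φ_j(S_j) acquires a large element
-- of R_i.  With k + 1 values of i, some Φ_j(S_j) meets two disjoint R_i infinitely often and
-- hence is not cohesive.
module Submission where

open import Defs
open import Level using (0ℓ)
open import Axiom.ExcludedMiddle using (ExcludedMiddle)
open import Data.Nat using (ℕ; zero; suc; _+_; _*_; _<_; _≤_; _⊔_; s≤s; z≤n; _≡ᵇ_)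
open import Data.Nat.Properties
open import Data.Bool using (Bool; true; false; if_then_else_)
open import Data.Bool.Properties using (T-≡)
open import Data.Empty using (⊥; ⊥-elim)
open import Data.Fin using (Fin; zero; suc; toℕ; punchIn; punchOut)
open import Data.Fin.Properties using (toℕ-injective; pigeonhole; punchOut-punchIn; punchInᵢ≢i) renaming (_≟_ to _≟ᶠ_; <⇒≢ to <ᶠ⇒≢)
open import Data.List using (List; []; _∷_; _++_; filter; upTo)
open import Data.List.Extrema.Nat using (max; xs≤max; ⊥≤max)
open import Data.List.Membership.Propositional using (_∈_)
open import Data.List.Membership.Propositional.Properties using (∈-++⁺ˡ; ∈-++⁺ʳ; ∈-++⁻; ∈-filter⁺; ∈-filter⁻; ∈-upTo⁺)
open import Data.List.Relation.Unary.All as All using ()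
open import Data.List.Relation.Unary.Any using (here)
open import Data.Maybe using (Maybe; just; nothing; map; zipWith)
open import Data.Maybe.Properties using (just-injective)
open import Data.Product using (Σ; _×_; _,_; proj₁; proj₂; ∃; ∃₂)
open import Data.Sum using (_⊎_; inj₁; inj₂; [_,_]′)
open import Data.Vec using (Vec; []; _∷_; lookup; _[_]≔_; replicate; tabulate; removeAt)
open import Data.Vec.Properties using (lookup∘update; lookup∘update′; lookup-replicate; lookup∘tabulate; removeAt-punchOut)
open import Function using (_∘_; id; Injective; _↣_; mk↣; Injection; Equivalence)
open import Function.Construct.Composition using (_↣-∘_)
open import Function.Construct.Identity using (↣-id)
open import Relation.Binary using (tri<; tri≈; tri>)
open import Relation.Binary.PropositionalEquality using (_≡_; _≢_; refl; sym; trans; cong; cong₂; subst)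
open import Relation.Nullary using (¬_; Dec; yes; no; does)

-- Countability

-- Abstract, so that unification can treat pair as injective.
abstract
  pair : ℕ → ℕ → ℕ
  pair a b = (a + b) * (a + b) + a

  -- With `s = a + b`, the value of `pair a b` lies between `s * s` and `s * s + s`, hence below the
  -- next square. Different sums thus give disjoint blocks, and inside a block the offset is `a`.
  pair-mono : ∀ {a b c d} → a + b < c + d → pair a b < pair c d
  pair-mono {a} {b} {c} {d} s<t = begin-strict
    (a + b) * (a + b) + a                  ≤⟨ +-monoʳ-≤ _ (m≤m+n a b) ⟩
    (a + b) * (a + b) + (a + b)            ≡⟨ +-comm _ (a + b) ⟩
    (a + b) + (a + b) * (a + b)            ≡⟨⟩
    suc (a + b) * (a + b)                  <⟨ *-monoʳ-< (suc (a + b)) (n<1+n (a + b)) ⟩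
    suc (a + b) * suc (a + b)              ≤⟨ *-mono-≤ s<t s<t ⟩
    (c + d) * (c + d)                      ≤⟨ m≤m+n _ c ⟩
    (c + d) * (c + d) + c                  ∎
    where open ≤-Reasoning

  pair-injective : ∀ {a b c d} → pair a b ≡ pair c d → a ≡ c × b ≡ d
  pair-injective {a} {b} {c} {d} eq with <-cmp (a + b) (c + d)
  ... | tri< s<t _ _ = ⊥-elim (<⇒≢ (pair-mono {a} {b} {c} {d} s<t) eq)
  ... | tri> _ _ s>t = ⊥-elim (<⇒≢ (pair-mono {c} {d} {a} {b} s>t) (sym eq))
  ... | tri≈ _ s≡t _ = a≡c , +-cancelˡ-≡ c b d (trans (cong (_+ b) (sym a≡c)) s≡t)
    where
    a≡c : a ≡ c
    a≡c = +-cancelˡ-≡ ((c + d) * (c + d)) a c (trans (cong (λ s → s * s + a) (sym s≡t)) eq)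

open Injection using (injective) renaming (to to encode)

×-countable : ∀ {A B : Set} → A ↣ ℕ → B ↣ ℕ → (A × B) ↣ ℕ
×-countable f g = mk↣ {to = λ (a , b) → pair (encode f a) (encode g b)} λ eq →
  let p , q = pair-injective eq in cong₂ _,_ (injective f p) (injective g q)

Σ-countable : ∀ {B : ℕ → Set} → (∀ k → B k ↣ ℕ) → Σ ℕ B ↣ ℕ
Σ-countable {B} f = mk↣ {to = enc} inj
  where
  enc : Σ ℕ B → ℕ
  enc (k , b) = pair k (encode (f k) b)

  inj : Injective _≡_ _≡_ enc
  inj {k , b} eq with refl , q ← pair-injective eq = cong (k ,_) (injective (f k) q)

⊎-countable : ∀ {A B : Set} → A ↣ ℕ → B ↣ ℕ → (A ⊎ B) ↣ ℕ
⊎-countable {A} {B} f g = mk↣ {to = enc} inj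
  where
  enc : A ⊎ B → ℕ
  enc (inj₁ a) = pair 0 (encode f a)
  enc (inj₂ b) = pair 1 (encode g b)

  inj : Injective _≡_ _≡_ enc
  inj {inj₁ a} {inj₁ _} eq = cong inj₁ (injective f (proj₂ (pair-injective eq)))
  inj {inj₂ b} {inj₂ _} eq = cong inj₂ (injective g (proj₂ (pair-injective eq)))
  inj {inj₁ a} {inj₂ b} eq with () ← proj₁ (pair-injective eq)
  inj {inj₂ b} {inj₁ a} eq with () ← proj₁ (pair-injective eq)

Fin-countable : ∀ k → Fin k ↣ ℕ
Fin-countable k = mk↣ (toℕ-injective {k})

Vec-countable : ∀ {A : Set} → A ↣ ℕ → ∀ k → Vec A k ↣ ℕ
Vec-countable {A} f k = mk↣ (inj {k})
  where
  enc : ∀ {k} → Vec A k → ℕ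
  enc []       = 0
  enc (x ∷ xs) = pair (encode f x) (enc xs)

  inj : ∀ {k} → Injective _≡_ _≡_ (enc {k})
  inj {x = []}     {[]}    _  = refl
  inj {x = x ∷ xs} {_ ∷ _} eq =
    let p , q = pair-injective eq in cong₂ _∷_ (injective f p) (inj q)

List-countable : ∀ {A : Set} → A ↣ ℕ → List A ↣ ℕ
List-countable {A} f = mk↣ {to = enc} inj
  where
  enc : List A → ℕ
  enc []       = 0
  enc (x ∷ xs) = suc (pair (encode f x) (enc xs))

  inj : Injective _≡_ _≡_ enc
  inj {[]}     {[]}    _  = refl
  inj {x ∷ xs} {_ ∷ _} eq =
    let p , q = pair-injective (suc-injective eq) in cong₂ _∷_ (injective f p) (inj q)

-- Tree codes for formulas and oracle programs

data Tree : Set where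
  leaf : ℕ → Tree
  node : Tree → Tree → Tree

Tree-countable : Tree ↣ ℕ
Tree-countable = mk↣ {to = enc} inj
  where
  enc : Tree → ℕ
  enc (leaf n)   = pair 0 n
  enc (node s t) = pair 1 (pair (enc s) (enc t))

  inj : Injective _≡_ _≡_ enc
  inj {leaf _} {leaf _} eq = cong leaf (proj₂ (pair-injective eq))
  inj {node s t} {node _ _} eq =
    let p , q = pair-injective (proj₂ (pair-injective eq)) in cong₂ node (inj p) (inj q)
  inj {leaf n} {node s t} eq with () ← proj₁ (pair-injective eq)
  inj {node s t} {leaf n} eq with () ← proj₁ (pair-injective eq)

-- A partial left inverse needs one case per constructor, whereas proving injectivity directly
-- compares all pairs of constructors.
retract-countable : ∀ {A : Set} (enc : A → Tree) (dec : Tree → Maybe A) →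
                    (∀ a → dec (enc a) ≡ just a) → A ↣ ℕ
retract-countable enc dec dec-enc = Tree-countable ↣-∘ mk↣ {to = enc} λ {x} {y} eq →
  just-injective (trans (sym (dec-enc x)) (trans (cong dec eq) (dec-enc y)))

encTerm : Term → Tree
encTerm (var i)  = leaf (suc i)
encTerm `0       = leaf 0
encTerm (`S t)   = node (leaf 0) (encTerm t)
encTerm (s `+ t) = node (leaf 1) (node (encTerm s) (encTerm t))
encTerm (s `* t) = node (leaf 2) (node (encTerm s) (encTerm t))

decTerm : Tree → Maybe Term
decTerm (leaf (suc i))               = just (var i)
decTerm (leaf zero)                  = just `0
decTerm (node (leaf 0) t)            = map `S (decTerm t)
decTerm (node (leaf 1) (node s t))   = zipWith _`+_ (decTerm s) (decTerm t)
decTerm (node (leaf 2) (node s t))   = zipWith _`*_ (decTerm s) (decTerm t)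
decTerm _                            = nothing

decTerm-encTerm : ∀ t → decTerm (encTerm t) ≡ just t
decTerm-encTerm (var i)  = refl
decTerm-encTerm `0       = refl
decTerm-encTerm (`S t)   rewrite decTerm-encTerm t = refl
decTerm-encTerm (s `+ t) rewrite decTerm-encTerm s | decTerm-encTerm t = refl
decTerm-encTerm (s `* t) rewrite decTerm-encTerm s | decTerm-encTerm t = refl

encFormula : Formula → Tree
encFormula (s `= t) = node (leaf 0) (node (encTerm s) (encTerm t))
encFormula (`R s t) = node (leaf 1) (node (encTerm s) (encTerm t))
encFormula (`¬ φ)   = node (leaf 2) (encFormula φ)
encFormula (φ `∧ ψ) = node (leaf 3) (node (encFormula φ) (encFormula ψ))
encFormula (φ `∨ ψ) = node (leaf 4) (node (encFormula φ) (encFormula ψ))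
encFormula (φ `⇒ ψ) = node (leaf 5) (node (encFormula φ) (encFormula ψ))
encFormula (`∀ φ)   = node (leaf 6) (encFormula φ)
encFormula (`∃ φ)   = node (leaf 7) (encFormula φ)

decFormula : Tree → Maybe Formula
decFormula (node (leaf 0) (node s t)) = zipWith _`=_ (decTerm s) (decTerm t)
decFormula (node (leaf 1) (node s t)) = zipWith `R (decTerm s) (decTerm t)
decFormula (node (leaf 2) φ)          = map `¬_ (decFormula φ)
decFormula (node (leaf 3) (node φ ψ)) = zipWith _`∧_ (decFormula φ) (decFormula ψ)
decFormula (node (leaf 4) (node φ ψ)) = zipWith _`∨_ (decFormula φ) (decFormula ψ)
decFormula (node (leaf 5) (node φ ψ)) = zipWith _`⇒_ (decFormula φ) (decFormula ψ)
decFormula (node (leaf 6) φ)          = map `∀ (decFormula φ)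
decFormula (node (leaf 7) φ)          = map `∃ (decFormula φ)
decFormula _                          = nothing

decFormula-encFormula : ∀ φ → decFormula (encFormula φ) ≡ just φ
decFormula-encFormula (s `= t) rewrite decTerm-encTerm s | decTerm-encTerm t = refl
decFormula-encFormula (`R s t) rewrite decTerm-encTerm s | decTerm-encTerm t = refl
decFormula-encFormula (`¬ φ)   rewrite decFormula-encFormula φ = refl
decFormula-encFormula (φ `∧ ψ) rewrite decFormula-encFormula φ | decFormula-encFormula ψ = refl
decFormula-encFormula (φ `∨ ψ) rewrite decFormula-encFormula φ | decFormula-encFormula ψ = refl
decFormula-encFormula (φ `⇒ ψ) rewrite decFormula-encFormula φ | decFormula-encFormula ψ = refl
decFormula-encFormula (`∀ φ)   rewrite decFormula-encFormula φ = refl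
decFormula-encFormula (`∃ φ)   rewrite decFormula-encFormula φ = refl

Formula-countable : Formula ↣ ℕ
Formula-countable = retract-countable encFormula decFormula decFormula-encFormula

decFin : ∀ n → ℕ → Maybe (Fin n)
decFin zero    _       = nothing
decFin (suc n) zero    = just zero
decFin (suc n) (suc i) = map suc (decFin n i)

decFin-toℕ : ∀ {n} (i : Fin n) → decFin n (toℕ i) ≡ just i
decFin-toℕ zero    = refl
decFin-toℕ (suc i) rewrite decFin-toℕ i = refl

mutual
  encCode : ∀ {n} → Code n → Tree
  encCode zer                = leaf 0
  encCode succ               = leaf 1
  encCode oracle             = leaf 2
  encCode (proj i)           = node (leaf 0) (leaf (toℕ i))
  -- The decoder is given the outer arity, but it can learn the intermediate arity `k` only from the
  -- code.
  encCode (comp {k} f gs)    = node (leaf 1) (node (leaf k) (node (encCode f) (encCodes gs)))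
  encCode (mu f)             = node (leaf 2) (encCode f)
  encCode (prec f g)         = node (leaf 3) (node (encCode f) (encCode g))

  encCodes : ∀ {k n} → Vec (Code n) k → Tree
  encCodes []       = leaf 0
  encCodes (g ∷ gs) = node (encCode g) (encCodes gs)

mutual
  decCode : ∀ n → Tree → Maybe (Code n)
  decCode n       (leaf 0)                                     = just zer
  decCode 1       (leaf 1)                                     = just succ
  decCode 1       (leaf 2)                                     = just oracle
  decCode n       (node (leaf 0) (leaf i))                     = map proj (decFin n i)
  decCode n       (node (leaf 1) (node (leaf k) (node f gs)))  = zipWith comp (decCode k f) (decCodes k n gs)
  decCode n       (node (leaf 2) f)                            = map mu (decCode (suc n) f)
  decCode (suc n) (node (leaf 3) (node f g))                   = zipWith prec (decCode n f) (decCode (2 + n) g)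
  decCode _       _                                            = nothing

  decCodes : ∀ k n → Tree → Maybe (Vec (Code n) k)
  decCodes zero    n (leaf 0)    = just []
  decCodes (suc k) n (node g gs) = zipWith _∷_ (decCode n g) (decCodes k n gs)
  decCodes _       _ _           = nothing

mutual
  decCode-encCode : ∀ {n} (e : Code n) → decCode n (encCode e) ≡ just e
  decCode-encCode zer         = refl
  decCode-encCode succ        = refl
  decCode-encCode oracle      = refl
  decCode-encCode (proj i)    rewrite decFin-toℕ i = refl
  decCode-encCode (comp f gs) rewrite decCode-encCode f | decCodes-encCodes gs = refl
  decCode-encCode (prec f g)  rewrite decCode-encCode f | decCode-encCode g = refl
  decCode-encCode (mu f)      rewrite decCode-encCode f = refl

  decCodes-encCodes : ∀ {k n} (gs : Vec (Code n) k) → decCodes k n (encCodes gs) ≡ just gs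
  decCodes-encCodes []       = refl
  decCodes-encCodes (g ∷ gs) rewrite decCode-encCode g | decCodes-encCodes gs = refl

Code-countable : ∀ n → Code n ↣ ℕ
Code-countable n = retract-countable encCode (decCode n) decCode-encCode

-- Determinism and the use principle

mutual
  Eval-deterministic : ∀ {X n} {e : Code n} {xs y y′} → Eval X e xs y → Eval X e xs y′ → y ≡ y′
  Eval-deterministic ev-zer ev-zer = refl
  Eval-deterministic ev-succ ev-succ = refl
  Eval-deterministic ev-proj ev-proj = refl
  Eval-deterministic ev-oracle ev-oracle = refl
  Eval-deterministic (ev-comp ds d) (ev-comp ds′ d′) with refl ← EvalAll-deterministic ds ds′ =
    Eval-deterministic d d′
  Eval-deterministic (ev-prec-z d) (ev-prec-z d′) = Eval-deterministic d d′
  Eval-deterministic (ev-prec-s c d) (ev-prec-s c′ d′) with refl ← Eval-deterministic c c′ =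
    Eval-deterministic d d′
  Eval-deterministic (ev-mu {y = y} d h) (ev-mu {y = y′} d′ h′) with <-cmp y y′
  ... | tri≈ _ y≡y′ _ = y≡y′
  ... | tri< y<y′ _ _ with () ← Eval-deterministic d (proj₂ (h′ y y<y′))
  ... | tri> _ _ y>y′ = ⊥-elim (Eval-not-both (h y′ y>y′) d′)

  Eval-not-both : ∀ {X n} {e : Code n} {xs} → (Σ ℕ λ v → Eval X e xs (suc v)) → ¬ Eval X e xs 0
  Eval-not-both (_ , d) d′ with () ← Eval-deterministic d d′

  EvalAll-deterministic : ∀ {X k n} {gs : Vec (Code n) k} {xs ys ys′} →
                          EvalAll X gs xs ys → EvalAll X gs xs ys′ → ys ≡ ys′
  EvalAll-deterministic [] [] = refl
  EvalAll-deterministic (d ∷ ds) (d′ ∷ ds′) =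
    cong₂ _∷_ (Eval-deterministic d d′) (EvalAll-deterministic ds ds′)

Agree : {A : Set} → ℕ → (ℕ → A) → (ℕ → A) → Set
Agree n f g = ∀ x → x < n → f x ≡ g x

Agree-≤ : ∀ {A : Set} {m n} {f g : ℕ → A} → m ≤ n → Agree n f g → Agree m f g
Agree-≤ m≤n a x x<m = a x (<-≤-trans x<m m≤n)

-- Serves the `mu` case of the use principle: the finitely many computations below the least zero
-- have separate uses, which the maximum merges into one.
bounded-collection : {P : ℕ → ℕ → Set} → (∀ {z u v} → u ≤ v → P z u → P z v) →
                     ∀ y → (∀ z → z < y → ∃ (P z)) → ∃ λ u → ∀ z → z < y → P z u
bounded-collection mono zero    h = 0 , λ _ ()
bounded-collection {P} mono (suc y) h
  with u , p ← bounded-collection {P} mono y (λ z z<y → h z (m<n⇒m<1+n z<y))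
  with v , q ← h y (n<1+n y) = u ⊔ v , bound
  where
  bound : ∀ z → z < suc y → P z (u ⊔ v)
  bound z z<1+y with m<1+n⇒m<n∨m≡n z<1+y
  ... | inj₁ z<y  = mono (m≤m⊔n u v) (p z z<y)
  ... | inj₂ refl = mono (m≤n⊔m u v) q

mutual
  -- A derivation is finite and consults the oracle finitely often. This is how a finite stem can
  -- settle a computation from the final set.
  Eval-use : ∀ {X n} {e : Code n} {xs y} → Eval X e xs y →
             ∃ λ u → ∀ Y → Agree u X Y → Eval Y e xs y
  Eval-use ev-zer = 0 , λ _ _ → ev-zer
  Eval-use ev-succ = 0 , λ _ _ → ev-succ
  Eval-use ev-proj = 0 , λ _ _ → ev-proj
  Eval-use {X} (ev-oracle {x}) = suc x , λ Y a →
    subst (Eval Y oracle (x ∷ [])) (cong (λ b → if b then 1 else 0) (sym (a x (n<1+n x)))) ev-oracle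
  Eval-use (ev-comp ds d) =
    let u , p = EvalAll-use ds
        v , q = Eval-use d
    in u ⊔ v , λ Y a → ev-comp (p Y (Agree-≤ (m≤m⊔n u v) a)) (q Y (Agree-≤ (m≤n⊔m u v) a))
  Eval-use (ev-prec-z d) = let u , p = Eval-use d in u , λ Y a → ev-prec-z (p Y a)
  Eval-use (ev-prec-s c d) =
    let u , p = Eval-use c
        v , q = Eval-use d
    in u ⊔ v , λ Y a → ev-prec-s (p Y (Agree-≤ (m≤m⊔n u v) a)) (q Y (Agree-≤ (m≤n⊔m u v) a))
  Eval-use {X} (ev-mu {f = f} {xs} {y} d h) =
    let u , p = Eval-use d
        v , q = bounded-collection {λ z w → ∀ Y → Agree w X Y → Σ ℕ λ r → Eval Y f (z ∷ xs) (suc r)}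
                  (λ w≤w′ p Y a → p Y (Agree-≤ w≤w′ a)) y (λ z z<y → Eval-suc-use (h z z<y))
    in u ⊔ v , λ Y a → ev-mu (p Y (Agree-≤ (m≤m⊔n u v) a))
                             (λ z z<y → q z z<y Y (Agree-≤ (m≤n⊔m u v) a))

  Eval-suc-use : ∀ {X n} {e : Code n} {xs} → (Σ ℕ λ r → Eval X e xs (suc r)) →
                 ∃ λ u → ∀ Y → Agree u X Y → Σ ℕ λ r → Eval Y e xs (suc r)
  Eval-suc-use (r , d) = let u , p = Eval-use d in u , λ Y a → r , p Y a

  EvalAll-use : ∀ {X k n} {gs : Vec (Code n) k} {xs ys} → EvalAll X gs xs ys →
                ∃ λ u → ∀ Y → Agree u X Y → EvalAll Y gs xs ys
  EvalAll-use [] = 0 , λ _ _ → []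
  EvalAll-use (d ∷ ds) =
    let u , p = Eval-use d
        v , q = EvalAll-use ds
    in u ⊔ v , λ Y a → p Y (Agree-≤ (m≤m⊔n u v) a) ∷ q Y (Agree-≤ (m≤n⊔m u v) a)

χ-true : ∀ {C x} → C x ≡ true → χ C x ≡ 1
χ-true x∈C = cong (λ c → if c then 1 else 0) x∈C

χ-1 : ∀ {C x} → χ C x ≡ 1 → C x ≡ true
χ-1 {C} {x} eq with C x
... | true  = refl

-- Chains and finite initial segments

bool-ext : ∀ {a b : Bool} → (a ≡ true → b ≡ true) → (b ≡ true → a ≡ true) → a ≡ b
bool-ext {true}  {b}     f g = sym (f refl)
bool-ext {false} {false} f g = refl
bool-ext {false} {true}  f g = g refl

Fin-bounded : ∀ {k} (f : Fin k → ℕ) → ∃ λ b → ∀ j → f j ≤ b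
Fin-bounded {zero}  f = 0 , λ ()
Fin-bounded {suc k} f = let b , f≤b = Fin-bounded (f ∘ suc) in f zero ⊔ b , λ where
  zero    → m≤m⊔n (f zero) b
  (suc j) → ≤-trans (f≤b j) (m≤n⊔m (f zero) b)

lookup-removeAt : ∀ {A : Set} {k} (xs : Vec A (suc k)) i j →
                  lookup (removeAt xs i) j ≡ lookup xs (punchIn i j)
lookup-removeAt xs i j = trans (cong (lookup (removeAt xs i)) (sym (punchOut-punchIn i)))
                               (removeAt-punchOut xs (punchInᵢ≢i i j ∘ sym))

dependent-choice : {St : Set} (R : ℕ → St → St → Set) → (∀ n p → Σ St (R n p)) → (p : St) →
                   Σ (ℕ → St) λ s → s 0 ≡ p × (∀ n → R n (s n) (s (suc n)))
dependent-choice {St} R next start = s , refl , λ n → proj₂ (next n (s n))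
  where
  s : ℕ → St
  s zero    = start
  s (suc n) = proj₁ (next n (s n))

chain-monotone : {St : Set} (_≼_ : St → St → Set) → (∀ {p} → p ≼ p) →
                 (∀ {p q r} → p ≼ q → q ≼ r → p ≼ r) →
                 (s : ℕ → St) → (∀ n → s n ≼ s (suc n)) → ∀ {m n} → m ≤ n → s m ≼ s n
chain-monotone _≼_ ≼-refl ≼-trans s h {m} {n} m≤n with m≤n⇒m<n∨m≡n m≤n
... | inj₂ refl = ≼-refl
chain-monotone _≼_ ≼-refl ≼-trans s h {m} {suc n} _ | inj₁ (s≤s m≤n) =
  ≼-trans (chain-monotone _≼_ ≼-refl ≼-trans s h m≤n) (h n)

-- The values of the function beyond the length are irrelevant.
record Prefix (A : Set) : Set where
  constructor _↾_
  field
    fun : ℕ → A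
    len : ℕ
open Prefix

module _ {A : Set} where

  infix 4 _⊑_

  _⊑_ : Prefix A → Prefix A → Set
  p ⊑ q = len p ≤ len q × Agree (len p) (fun p) (fun q)

  ⊑-refl : ∀ {p} → p ⊑ p
  ⊑-refl = ≤-refl , λ _ _ → refl

  ⊑-trans : ∀ {p q r} → p ⊑ q → q ⊑ r → p ⊑ r
  ⊑-trans (p≤q , a) (q≤r , b) =
    ≤-trans p≤q q≤r , λ x x<p → trans (a x x<p) (b x (<-≤-trans x<p p≤q))

  ↾-mono : ∀ {f : ℕ → A} {m n} → m ≤ n → (f ↾ m) ⊑ (f ↾ n)
  ↾-mono m≤n = m≤n , λ _ _ → refl

  -- Used in two ways: to send a whole block of candidates to one value `i`, and in `König` to
  -- append a single colour.
  extendBy : A → ℕ → Prefix A → Prefix A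
  extendBy a N (f ↾ n) = f′ ↾ (n ⊔ N)
    where
    f′ : ℕ → A
    f′ x with x <? n
    ... | yes _ = f x
    ... | no _  = a

  extendBy-⊒ : ∀ a N p → p ⊑ extendBy a N p
  extendBy-⊒ a N (f ↾ n) = m≤m⊔n n N , λ x x<n → agree x x<n
    where
    agree : Agree n f (fun (extendBy a N (f ↾ n)))
    agree x x<n with x <? n
    ... | yes _  = refl
    ... | no x≮n = ⊥-elim (x≮n x<n)

  extendBy-new : ∀ a N p {x} → len p ≤ x → fun (extendBy a N p) x ≡ a
  extendBy-new a N (f ↾ n) {x} n≤x with x <? n
  ... | yes x<n = ⊥-elim (<⇒≱ x<n n≤x)
  ... | no _    = refl

  limit : (s : ℕ → Prefix A) → (∀ n → s n ⊑ s (suc n)) → (∀ n → n ≤ len (s n)) →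
          Σ (ℕ → A) λ G → ∀ n → s n ⊑ (G ↾ len (s n))
  -- Stage `suc x` has length greater than `x`, so its value at `x` is final.
  limit s h long = (λ x → fun (s (suc x)) x) , λ n → ≤-refl , agree n
    where
    mono : ∀ {m n} → m ≤ n → s m ⊑ s n
    mono = chain-monotone _⊑_ ⊑-refl ⊑-trans s h

    agree : ∀ n x → x < len (s n) → fun (s n) x ≡ fun (s (suc x)) x
    agree n x x<len with ≤-total n (suc x)
    ... | inj₁ n≤1+x = proj₂ (mono n≤1+x) x x<len
    ... | inj₂ 1+x≤n = sym (proj₂ (mono 1+x≤n) x (long (suc x)))

  increasing-length : (s : ℕ → Prefix A) → (∀ n → len (s n) < len (s (suc n))) → ∀ n → n ≤ len (s n)
  increasing-length s h zero    = z≤n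
  increasing-length s h (suc n) = ≤-<-trans (increasing-length s h n) (h n)

  UpClosed : (Prefix A → Set) → Set
  UpClosed D = ∀ {p q} → p ⊑ q → D p → D q

  -- The clause that 1-genericity imposes for c.e. sets of conditions, here for an arbitrary `D`; it
  -- makes sense without density of `D`.
  Decides : (ℕ → A) → (Prefix A → Set) → Set
  Decides G D = ∃ λ n → D (G ↾ n) ⊎ (∀ q → (G ↾ n) ⊑ q → ¬ D q)

-- Forcing

-- Only environments given by lists are forced about, which keeps the forcing requirements
-- countable.
env : List ℕ → Env
env []       = ρ₀
env (x ∷ xs) = x ∷ₑ env xs

-- Cohen's strong forcing, with `R` read as the fibres of the generic function. An implication is
-- treated as "not `φ`, or `ψ`", and `∀` as "not exists not".
Forces : Prefix ℕ → List ℕ → Formula → Set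
Forces p ρ (t `= s)  = ⟦ t ⟧ₜ (env ρ) ≡ ⟦ s ⟧ₜ (env ρ)
Forces p ρ (`R t s)  = ⟦ s ⟧ₜ (env ρ) < len p × (fun p (⟦ s ⟧ₜ (env ρ)) ≡ᵇ ⟦ t ⟧ₜ (env ρ)) ≡ true
Forces p ρ (`¬ φ)    = ∀ q → p ⊑ q → ¬ Forces q ρ φ
Forces p ρ (φ `∧ ψ)  = Forces p ρ φ × Forces p ρ ψ
Forces p ρ (φ `∨ ψ)  = Forces p ρ φ ⊎ Forces p ρ ψ
Forces p ρ (φ `⇒ ψ)  = (∀ q → p ⊑ q → ¬ Forces q ρ φ) ⊎ Forces p ρ ψ
Forces p ρ (`∀ φ)    = ∀ x q → p ⊑ q → ¬ (∀ r → q ⊑ r → ¬ Forces r (x ∷ ρ) φ)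
Forces p ρ (`∃ φ)    = ∃ λ x → Forces p (x ∷ ρ) φ

Forces-mono : ∀ φ {ρ} → UpClosed (λ p → Forces p ρ φ)
Forces-mono (t `= s) p⊑q f = f
Forces-mono (`R t s) {ρ} p⊑q (x<p , f) =
  <-≤-trans x<p (proj₁ p⊑q) , subst (λ y → (y ≡ᵇ ⟦ t ⟧ₜ (env ρ)) ≡ true) (proj₂ p⊑q _ x<p) f
Forces-mono (`¬ φ) p⊑q f = λ r q⊑r → f r (⊑-trans p⊑q q⊑r)
Forces-mono (φ `∧ ψ) p⊑q (f , g) = Forces-mono φ p⊑q f , Forces-mono ψ p⊑q g
Forces-mono (φ `∨ ψ) p⊑q (inj₁ f) = inj₁ (Forces-mono φ p⊑q f)
Forces-mono (φ `∨ ψ) p⊑q (inj₂ g) = inj₂ (Forces-mono ψ p⊑q g)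
Forces-mono (φ `⇒ ψ) p⊑q (inj₁ f) = inj₁ λ r q⊑r → f r (⊑-trans p⊑q q⊑r)
Forces-mono (φ `⇒ ψ) p⊑q (inj₂ g) = inj₂ (Forces-mono ψ p⊑q g)
Forces-mono (`∀ φ) p⊑q f = λ x r q⊑r → f x r (⊑-trans p⊑q q⊑r)
Forces-mono (`∃ φ) p⊑q (x , f) = x , Forces-mono φ p⊑q f

fibres : (ℕ → ℕ) → SetSeq
fibres G i x = G x ≡ᵇ i

module Truth (G : ℕ → ℕ) (decides : ∀ φ ρ → Decides G (λ p → Forces p ρ φ)) where

  Forces-consistent : ∀ φ {ρ m n} → Forces (G ↾ m) ρ (`¬ φ) → ¬ Forces (G ↾ n) ρ φ
  Forces-consistent φ {ρ} {m} {n} f g =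
    f (G ↾ (m ⊔ n)) (↾-mono (m≤m⊔n m n)) (Forces-mono φ {ρ} (↾-mono (m≤n⊔m m n)) g)

  mutual
    -- The truth lemma for generic `G`. Both directions go by one simultaneous induction, because
    -- negation and implication exchange them.
    Forces⇒Sat : ∀ φ {ρ n} → Forces (G ↾ n) ρ φ → Sat (fibres G) (env ρ) φ
    Forces⇒Sat (t `= s) f = f
    Forces⇒Sat (`R t s) (_ , f) = f
    Forces⇒Sat (`¬ φ) {n = n} f sat = Forces-consistent φ {m = n} f (proj₂ (Sat⇒Forces φ sat))
    Forces⇒Sat (φ `∧ ψ) (f , g) = Forces⇒Sat φ f , Forces⇒Sat ψ g
    Forces⇒Sat (φ `∨ ψ) (inj₁ f) = inj₁ (Forces⇒Sat φ f)
    Forces⇒Sat (φ `∨ ψ) (inj₂ g) = inj₂ (Forces⇒Sat ψ g)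
    Forces⇒Sat (φ `⇒ ψ) {n = n} (inj₁ f) sat =
      ⊥-elim (Forces-consistent φ {m = n} f (proj₂ (Sat⇒Forces φ sat)))
    Forces⇒Sat (φ `⇒ ψ) (inj₂ g) _ = Forces⇒Sat ψ g
    Forces⇒Sat (`∀ φ) {ρ} {n} f x with decides φ (x ∷ ρ)
    ... | m , inj₁ g     = Forces⇒Sat φ g
    ... | m , inj₂ avoid = ⊥-elim (f x (G ↾ (n ⊔ m)) (↾-mono (m≤m⊔n n m))
                             λ r q⊑r → avoid r (⊑-trans (↾-mono (m≤n⊔m n m)) q⊑r))
    Forces⇒Sat (`∃ φ) (x , f) = x , Forces⇒Sat φ f

    Sat⇒Forces : ∀ φ {ρ} → Sat (fibres G) (env ρ) φ → ∃ λ n → Forces (G ↾ n) ρ φ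
    Sat⇒Forces (t `= s) sat = 0 , sat
    Sat⇒Forces (`R t s) sat = _ , ≤-refl , sat
    Sat⇒Forces (`¬ φ) {ρ} ¬sat with decides φ ρ
    ... | n , inj₁ f     = ⊥-elim (¬sat (Forces⇒Sat φ f))
    ... | n , inj₂ avoid = n , avoid
    Sat⇒Forces (φ `∧ ψ) {ρ} (sat , sat′)
      with m , f ← Sat⇒Forces φ sat | n , g ← Sat⇒Forces ψ sat′ =
      m ⊔ n , Forces-mono φ {ρ} (↾-mono (m≤m⊔n m n)) f , Forces-mono ψ {ρ} (↾-mono (m≤n⊔m m n)) g
    Sat⇒Forces (φ `∨ ψ) (inj₁ sat) = let n , f = Sat⇒Forces φ sat in n , inj₁ f
    Sat⇒Forces (φ `∨ ψ) (inj₂ sat) = let n , f = Sat⇒Forces ψ sat in n , inj₂ f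
    Sat⇒Forces (φ `⇒ ψ) {ρ} imp with decides φ ρ
    ... | _ , inj₁ f     = let n , g = Sat⇒Forces ψ (imp (Forces⇒Sat φ f)) in n , inj₂ g
    ... | n , inj₂ avoid = n , inj₁ avoid
    -- Having no extension that forces a counterexample is, up to currying, the definition of
    -- forcing `∀`.
    Sat⇒Forces (`∀ φ) {ρ} sat with decides (`∃ (`¬ φ)) ρ
    ... | n , inj₁ (x , f) = ⊥-elim (Forces-consistent φ {m = n} f (proj₂ (Sat⇒Forces φ (sat x))))
    ... | n , inj₂ avoid   = n , λ x q G⊑q f → avoid q G⊑q (x , f)
    Sat⇒Forces (`∃ φ) (x , sat) = let n , f = Sat⇒Forces φ sat in n , x , f

-- Fibres and cohesiveness

fibre⁺ : ∀ {G i x} → G x ≡ i → fibres G i x ≡ true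
fibre⁺ {G} {i} {x} eq = Equivalence.to T-≡ (≡⇒≡ᵇ (G x) i eq)

fibre⁻ : ∀ {G i x} → fibres G i x ≡ true → G x ≡ i
fibre⁻ {G} {i} {x} eq = ≡ᵇ⇒≡ (G x) i (Equivalence.from T-≡ eq)

-- Distinct fibres are disjoint, so the elements over `i′` lie in the complement of the fibre over
-- `i`, and `C` is split by that one fibre.
not-cohesive : ∀ {G C i i′} → i ≢ i′ →
               (∀ b → ∃ λ x → b ≤ x × G x ≡ i × C x ≡ true) →
               (∀ b → ∃ λ x → b ≤ x × G x ≡ i′ × C x ≡ true) → ¬ Cohesive (fibres G) C
not-cohesive {G} {C} {i} {i′} i≢i′ often often′ (_ , split) with split i
... | inj₁ (b , bound) with x , b≤x , Gx≡i , x∈C ← often b =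
  <⇒≱ (bound x (trans (cong (λ c → if c then fibres G i x else false) x∈C) (fibre⁺ {G} {i} {x} Gx≡i))) b≤x
... | inj₂ (b , bound) with x , b≤x , Gx≡i′ , x∈C ← often′ b =
  <⇒≱ (bound x (trans (cong (λ c → if c then complement (fibres G i) x else false) x∈C) outside)) b≤x
  where
  outside : complement (fibres G i) x ≡ true
  outside with fibres G i x in eq
  ... | true  = ⊥-elim (i≢i′ (trans (sym (fibre⁻ {G} {i} {x} eq)) Gx≡i′))
  ... | false = refl

-- Classical principles, existence of generics, compactness

module Classical (em : ExcludedMiddle 0ℓ) where

  by-contradiction : {P : Set} → ¬ ¬ P → P
  by-contradiction {P} ¬¬p with em {P}
  ... | yes p = p
  ... | no ¬p = ⊥-elim (¬¬p ¬p)

  ¬∀⇒∃¬ : {A : Set} {P : A → Set} → ¬ (∀ a → P a) → ∃ λ a → ¬ P a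
  ¬∀⇒∃¬ ¬∀ = by-contradiction λ ¬∃ → ¬∀ λ a → by-contradiction λ ¬p → ¬∃ (a , ¬p)

  abstract
    ⟪_⟫ : (ℕ → Set) → Subset
    ⟪ P ⟫ n = does (em {P n})

    ⟪⟫⁺ : ∀ {P : ℕ → Set} {n} → P n → ⟪ P ⟫ n ≡ true
    ⟪⟫⁺ {P} {n} p with em {P n}
    ... | yes _ = refl
    ... | no ¬p = ⊥-elim (¬p p)

    ⟪⟫⁻ : ∀ {P : ℕ → Set} {n} → ⟪ P ⟫ n ≡ true → P n
    ⟪⟫⁻ {P} {n} _ with yes p ← em {P n} = p

  -- If each `j` failed at some bound, then all of them would fail at the largest of these finitely
  -- many bounds.
  infinite-pigeonhole : ∀ {k} (P : Fin k → ℕ → Set) → (∀ {j a b} → a ≤ b → P j b → P j a) →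
                        (∀ b → ∃ λ j → P j b) → ∃ λ j → ∀ b → P j b
  infinite-pigeonhole P antitone h = by-contradiction λ ¬∃ →
    let fails   = λ j → ¬∀⇒∃¬ λ all → ¬∃ (j , all)
        b , f≤b = Fin-bounded (proj₁ ∘ fails)
        j , p   = h b
    in proj₂ (fails j) (antitone (f≤b j) p)

  -- Stage `n` treats the index with code `n`: it moves into `D i` if some extension lies there, and
  -- otherwise the current prefix already avoids `D i`. Every stage also lengthens the prefix, so
  -- the limit is total.
  generic-exists : {A I : Set} → I ↣ ℕ → A → (D : I → Prefix A → Set) → (∀ i → UpClosed (D i)) →
                   Σ (ℕ → A) λ G → ∀ i → Decides G (D i)
  generic-exists {A} {I} code a D D-up = G , decides
    where
    Next : ℕ → Prefix A → Prefix A → Set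
    Next n p q = p ⊑ q × len p < len q ×
                 (∀ i → encode code i ≡ n → D i q ⊎ (∀ r → p ⊑ r → ¬ D i r))

    lengthen : Prefix A → Prefix A
    lengthen (f ↾ n) = f ↾ suc n

    lengthen-⊒ : ∀ {p} → p ⊑ lengthen p
    lengthen-⊒ = n≤1+n _ , λ _ _ → refl

    next : ∀ n p → Σ (Prefix A) (Next n p)
    next n p with em {Σ I λ i → encode code i ≡ n × Σ (Prefix A) λ q → p ⊑ q × D i q}
    ... | yes (i , refl , q , p⊑q , d) =
      lengthen q , ⊑-trans p⊑q lengthen-⊒ , s≤s (proj₁ p⊑q) , λ i′ eq →
        inj₁ (D-up i′ lengthen-⊒ (subst (λ i → D i q) (sym (injective code eq)) d))
    ... | no none = lengthen p , lengthen-⊒ , ≤-refl , λ i eq →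
        inj₂ λ r p⊑r d → none (i , eq , r , p⊑r , d)

    seq = dependent-choice Next next ((λ _ → a) ↾ 0)
    s = proj₁ seq
    h = proj₂ (proj₂ seq)

    lim = limit s (proj₁ ∘ h) (increasing-length s (proj₁ ∘ proj₂ ∘ h))
    G = proj₁ lim

    decides : ∀ i → Decides G (D i)
    decides i with proj₂ (proj₂ (h (encode code i))) i refl
    ... | inj₁ d     = _ , inj₁ (D-up i (proj₂ lim (suc (encode code i))) d)
    ... | inj₂ avoid = _ , inj₂ λ q G⊑q → avoid q (⊑-trans (proj₂ lim (encode code i)) G⊑q)

  -- A prefix is live if at every level some good colouring extends it. By the pigeonhole principle
  -- one of the `k` next colours keeps it live, so live prefixes can be prolonged forever.
  König : ∀ {k} (P : ℕ → (ℕ → Fin k) → Set) → (∀ {a b c} → a ≤ b → P b c → P a c) →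
          (∀ {n c d} → Agree n c d → P n c → P n d) →
          (∀ n → ∃ (P n)) → ∃ λ c → ∀ n → P n c
  König {k} P antitone local h = c , path
    where
    LiveAt : Prefix (Fin k) → ℕ → Set
    LiveAt p n = ∃ λ d → Agree (len p) (fun p) d × P n d

    Live : Set
    Live = Σ (Prefix (Fin k)) λ p → ∀ n → LiveAt p n

    Next : ℕ → Live → Live → Set
    Next _ p q = proj₁ p ⊑ proj₁ q × len (proj₁ p) < len (proj₁ q)

    next : ∀ n p → Σ Live (Next n p)
    next _ (p , live) = (q (proj₁ good) , proj₂ good) ,
      extendBy-⊒ (proj₁ good) (suc (len p)) p , <-≤-trans (n<1+n _) (m≤n⊔m _ _)
      where
      q : Fin k → Prefix (Fin k)
      q a = extendBy a (suc (len p)) p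

      colour : ∀ b → ∃ λ a → LiveAt (q a) b
      colour b with d , agree , pd ← live b = d (len p) , d , agree′ , pd
        where
        agree′ : Agree (len (q (d (len p)))) (fun (q (d (len p)))) d
        agree′ x x<len with <-cmp x (len p)
        ... | tri< x<n _ _ =
          trans (sym (proj₂ (extendBy-⊒ (d (len p)) (suc (len p)) p) x x<n)) (agree x x<n)
        ... | tri≈ _ refl _ = extendBy-new _ (suc (len p)) p ≤-refl
        ... | tri> _ _ x>n =
          ⊥-elim (<⇒≱ x<len (≤-trans (⊔-lub (n≤1+n _) ≤-refl) x>n))

      good : ∃ λ a → ∀ b → LiveAt (q a) b
      good = infinite-pigeonhole (λ a → LiveAt (q a))
               (λ a≤b (d , agree , pd) → d , agree , antitone a≤b pd) colour

    -- Even the empty prefix carries a function into `Fin k`; the witness for level 0 provides one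
    -- without a proof that `k` is positive.
    seq = dependent-choice Next next ((proj₁ (h 0) ↾ 0) , λ n → proj₁ (h n) , (λ _ ()) , proj₂ (h n))
    s = proj₁ seq
    step = proj₂ (proj₂ seq)

    long : ∀ n → n ≤ len (proj₁ (s n))
    long = increasing-length (proj₁ ∘ s) (proj₂ ∘ step)

    lim = limit (proj₁ ∘ s) (proj₁ ∘ step) long
    c = proj₁ lim

    path : ∀ n → P n c
    path n with d , agree , pd ← proj₂ (s n) n =
      local (λ x x<n → let x<len = <-≤-trans x<n (long n) in
               trans (sym (agree x x<len)) (proj₂ (proj₂ lim n) x x<len)) pd

  -- Reservoirs

  module _ {k : ℕ} (E : Vec (List ℕ) k) (es : Vec (Code 1) k) where

    -- Output 1 means that the `j`-th functional puts `x` into its set. `E` holds the stems already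
    -- built, and `F` is a proposed addition to the `j`-th.
    Accepts : Fin k → List ℕ → ℕ → Set
    Accepts j F x = Eval ⟪ _∈ F ++ lookup E j ⟫ (lookup es j) (x ∷ []) 1

    Barren : Subset → ℕ → (ℕ → Fin k) → Set
    Barren X b c = ∀ j F x → b ≤ x → (∀ y → y ∈ F → X y ≡ true × c y ≡ j) → ¬ Accepts j F x

    -- The finite approximation to `Barren`: it looks at `c` only below `N`, which is the locality
    -- that `König` demands.
    BarrenBelow : Subset → ℕ → ℕ → (ℕ → Fin k) → Set
    BarrenBelow X b N c = ∀ j F x → b ≤ x → x < N →
      (∀ y → y ∈ F → y < N × X y ≡ true × c y ≡ j) → ¬ Accepts j F x

    barren-compactness : ∀ X b → (∀ N → ∃ (BarrenBelow X b N)) → ∃ (Barren X b)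
    barren-compactness X b h =
      let c , barren = König (BarrenBelow X b) antitone local h in
      -- A violation involves one `x` and one finite `F`, so it already shows below this level.
      c , λ j F x b≤x F⊆ → barren (suc (max x F)) j F x b≤x
        (s≤s (⊥≤max x F)) λ y y∈F → s≤s (All.lookup (xs≤max x F) y∈F) , F⊆ y y∈F
      where
      antitone : ∀ {m n c} → m ≤ n → BarrenBelow X b n c → BarrenBelow X b m c
      antitone m≤n barren j F x b≤x x<m F⊆ = barren j F x b≤x (<-≤-trans x<m m≤n)
        λ y y∈F → let y<m , rest = F⊆ y y∈F in <-≤-trans y<m m≤n , rest

      local : ∀ {n c d} → Agree n c d → BarrenBelow X b n c → BarrenBelow X b n d
      local c~d barren j F x b≤x x<n F⊆ = barren j F x b≤x x<n
        λ y y∈F → let y<n , y∈X , dy≡j = F⊆ y y∈F in y<n , y∈X , trans (c~d y y<n) dy≡j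

    -- The colouring is the one found by excluded middle, so a colour class is determined by `X` and
    -- finite data and can be named. Without a barren colouring, `X` is a default.
    cellOf : ∀ X b → Dec (∃ (Barren X b)) → Fin k → Subset
    cellOf X b (yes (c , _)) j = ⟪ (λ y → X y ≡ true × c y ≡ j) ⟫
    cellOf X b (no _)        j = X

    cell : Subset → ℕ → Fin k → Subset
    cell X b = cellOf X b em

    cell-spec : ∀ {X b} → ∃ (Barren X b) →
                ∃ λ c → Barren X b c × (∀ j → cell X b j ≡ ⟪ (λ y → X y ≡ true × c y ≡ j) ⟫)
    cell-spec {X} {b} w with em {∃ (Barren X b)}
    ... | yes (c , barren) = c , barren , λ _ → refl
    ... | no ¬w            = ⊥-elim (¬w w)

  truncate : ℕ → Subset → Subset
  truncate b X = ⟪ (λ y → X y ≡ true × b ≤ y) ⟫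

  truncate-infinite : ∀ {b X} → Infinite X → Infinite (truncate b X)
  truncate-infinite {b} inf a with y , le , y∈X ← inf (a ⊔ b) =
    y , m⊔n≤o⇒m≤o a b le , ⟪⟫⁺ (y∈X , m⊔n≤o⇒n≤o a b le)

  -- One thinning of a reservoir: truncation at a bound, or passage to a colour class of a barren
  -- colouring. Its parameters are finite data, so names are countable.
  Step : Set
  Step = ℕ ⊎ (Σ ℕ λ k → Vec (List ℕ) k × Vec (Code 1) k × ℕ × Fin k)

  Name : Set
  Name = List Step

  -- The sets with a name play the role of a countable ground model.
  ⟦_⟧ : Name → Subset
  ⟦ [] ⟧                               = λ _ → true
  ⟦ inj₁ b ∷ N ⟧                       = truncate b ⟦ N ⟧
  ⟦ inj₂ (k , E , es , b , j) ∷ N ⟧    = cell E es ⟦ N ⟧ b j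

  Name-countable : Name ↣ ℕ
  Name-countable = List-countable (⊎-countable (↣-id ℕ) (Σ-countable λ k →
    ×-countable (Vec-countable (List-countable (↣-id ℕ)) k)
      (×-countable (Vec-countable (Code-countable 1) k) (×-countable (↣-id ℕ) (Fin-countable k)))))

  -- Genericity requirements

  Index : Set
  Index = (Formula × List ℕ)
        ⊎ (Σ ℕ λ k → Vec Formula k × Name)
        ⊎ (Σ ℕ λ k → Vec Formula k × Vec (List ℕ) k × Name × Vec (Code 1) k × ℕ × ℕ)

  Index-countable : Index ↣ ℕ
  Index-countable =
    ⊎-countable (×-countable Formula-countable (List-countable (↣-id ℕ)))
    (⊎-countable (Σ-countable λ k → ×-countable (Vec-countable Formula-countable k) Name-countable)
    (Σ-countable λ k → ×-countable (Vec-countable Formula-countable k)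
      (×-countable (Vec-countable (List-countable (↣-id ℕ)) k) (×-countable Name-countable
      (×-countable (Vec-countable (Code-countable 1) k) (×-countable (↣-id ℕ) (↣-id ℕ)))))))

  -- The condition `p` forces that some point of `X` satisfies none of the formulas.
  Uncovers : ∀ {k} → Vec Formula k → Subset → Prefix ℕ → Set
  Uncovers φs X p = ∃ λ y → X y ≡ true × (∀ j q → p ⊑ q → ¬ Forces q (y ∷ []) (lookup φs j))

  -- The positive side of Seetapun's dichotomy, as seen by a condition: `p` has placed a large `x`
  -- in the `i`-th fibre and forces a finite set that accepts `x` to lie inside one class.
  Achieves : ∀ {k} → Vec Formula k → Vec (List ℕ) k → Subset → Vec (Code 1) k → ℕ → ℕ → Prefix ℕ → Set
  Achieves φs E X es i b p = ∃ λ j → ∃₂ λ F x →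
    b ≤ x × (x < len p × fun p x ≡ i) ×
    (∀ y → y ∈ F → X y ≡ true × Forces p (y ∷ []) (lookup φs j)) × Accepts E es j F x

  Requirement : Index → Prefix ℕ → Set
  Requirement (inj₁ (φ , ρ)) p                               = Forces p ρ φ
  Requirement (inj₂ (inj₁ (k , φs , N))) p                   = Uncovers φs ⟦ N ⟧ p
  Requirement (inj₂ (inj₂ (k , φs , E , N , es , i , b))) p  = Achieves φs E ⟦ N ⟧ es i b p

  Requirement-up : ∀ i → UpClosed (Requirement i)
  Requirement-up (inj₁ (φ , ρ)) = Forces-mono φ {ρ}
  Requirement-up (inj₂ (inj₁ _)) p⊑q (y , y∈X , f) = y , y∈X , λ j r q⊑r → f j r (⊑-trans p⊑q q⊑r)
  Requirement-up (inj₂ (inj₂ (k , φs , _))) p⊑q (j , F , x , b≤x , (x<p , px≡i) , F⊆ , acc) =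
    j , F , x , b≤x , (<-≤-trans x<p (proj₁ p⊑q) , trans (sym (proj₂ p⊑q x x<p)) px≡i) ,
    (λ y y∈F → let y∈X , f = F⊆ y y∈F in y∈X , Forces-mono (lookup φs j) p⊑q f) , acc

  generic : Σ (ℕ → ℕ) λ G → ∀ i → Decides G (Requirement i)
  generic = generic-exists Index-countable 0 Requirement Requirement-up

  -- Mathias forcing

  module Mathias {k : ℕ} (B : Fin k → ℕ → Set) (N : Name) where

    -- A Mathias condition with one stem per colour and a common reservoir. The reservoir is held by
    -- name, so the genericity requirements speak about it.
    record State : Set where
      field
        stem         : Vec (List ℕ) k
        name         : Name
        name⊆        : ⟦ name ⟧ ⊆ ⟦ N ⟧
        nameInfinite : Infinite ⟦ name ⟧
    open State public

    _∈[_]_ : ℕ → Fin k → State → Set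
    y ∈[ j ] σ = y ∈ lookup (stem σ) j

    record _≼_ (σ τ : State) : Set where
      constructor ext
      field
        grow   : ∀ j y → y ∈[ j ] σ → y ∈[ j ] τ
        new    : ∀ j y → y ∈[ j ] τ → y ∈[ j ] σ ⊎ (⟦ name σ ⟧ y ≡ true × B j y)
        shrink : ⟦ name τ ⟧ ⊆ ⟦ name σ ⟧
    open _≼_

    ≼-refl : ∀ {σ} → σ ≼ σ
    ≼-refl = ext (λ _ _ → id) (λ _ _ → inj₁) (λ _ → id)

    ≼-trans : ∀ {σ τ υ} → σ ≼ τ → τ ≼ υ → σ ≼ υ
    ≼-trans {σ} {τ} {υ} a b = ext (λ j y → grow b j y ∘ grow a j y) new′ (λ y → shrink a y ∘ shrink b y)
      where
      new′ : ∀ j y → y ∈[ j ] υ → y ∈[ j ] σ ⊎ (⟦ name σ ⟧ y ≡ true × B j y)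
      new′ j y y∈υ with new b j y y∈υ
      ... | inj₁ y∈τ        = new a j y y∈τ
      ... | inj₂ (y∈X , By) = inj₂ (shrink a y y∈X , By)

    record Compatible (σ : State) (S : Fin k → Subset) : Set where
      field
        stem⊆ : ∀ j y → y ∈[ j ] σ → S j y ≡ true
        ⊆stem : ∀ j y → S j y ≡ true → y ∈[ j ] σ ⊎ (⟦ name σ ⟧ y ≡ true × B j y)
    open Compatible public

    -- A request is met for all compatible families at once, so it stays met at later stages; the
    -- union of the stems is compatible with every stage.
    meet-all : {I : Set} → I ↣ ℕ → (Q : I → (Fin k → Subset) → Set) →
               (∀ i σ → Σ State λ τ → σ ≼ τ × (∀ S → Compatible τ S → Q i S)) →
               ∀ σ → Σ (Fin k → Subset) λ S → Compatible σ S × (∀ i → Q i S)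
    meet-all {I} code Q dense σ =
      S , subst (λ σ → Compatible σ S) start (compatible 0) ,
      λ i → proj₂ (h (encode code i)) i refl S (compatible (suc (encode code i)))
      where
      Next : ℕ → State → State → Set
      Next n σ τ = σ ≼ τ × (∀ i → encode code i ≡ n → ∀ S → Compatible τ S → Q i S)

      next : ∀ n σ → Σ State (Next n σ)
      next n σ with em {∃ λ i → encode code i ≡ n}
      ... | no none = σ , ≼-refl , λ i eq → ⊥-elim (none (i , eq))
      ... | yes (i , refl) with τ , σ≼τ , met ← dense i σ =
        τ , σ≼τ , λ i′ eq → subst (λ i → ∀ S → Compatible τ S → Q i S) (sym (injective code eq)) met

      seq = dependent-choice Next next σ
      s = proj₁ seq
      start = proj₁ (proj₂ seq)
      h = proj₂ (proj₂ seq)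

      mono : ∀ {m n} → m ≤ n → s m ≼ s n
      mono = chain-monotone _≼_ ≼-refl ≼-trans s (proj₁ ∘ h)

      S : Fin k → Subset
      S j = ⟪ (λ y → ∃ λ n → y ∈[ j ] s n) ⟫

      compatible : ∀ n → Compatible (s n) S
      compatible n .stem⊆ j y y∈s = ⟪⟫⁺ (n , y∈s)
      compatible n .⊆stem j y y∈S with m , y∈sm ← ⟪⟫⁻ {λ y → ∃ λ n → y ∈[ j ] s n} y∈S with ≤-total m n
      ... | inj₁ m≤n = inj₁ (grow (mono m≤n) j y y∈sm)
      ... | inj₂ n≤m = new (mono n≤m) j y y∈sm

    -- Truncating the reservoir at `u` freezes the `j`-th set below `u`. With `u` the use of a
    -- computation, that computation is preserved.
    enlarge : State → Fin k → List ℕ → ℕ → State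
    enlarge σ j F u = record
      { stem         = stem σ [ j ]≔ (F ++ lookup (stem σ) j)
      ; name         = inj₁ u ∷ name σ
      ; name⊆        = λ y y∈ → name⊆ σ y (proj₁ (⟪⟫⁻ y∈))
      ; nameInfinite = truncate-infinite (nameInfinite σ)
      }

    module _ (σ : State) (j : Fin k) (F : List ℕ) (u : ℕ) where

      enlarge-stem : lookup (stem (enlarge σ j F u)) j ≡ F ++ lookup (stem σ) j
      enlarge-stem = lookup∘update j (stem σ) _

      enlarge-≽ : (∀ y → y ∈ F → ⟦ name σ ⟧ y ≡ true × B j y) → σ ≼ enlarge σ j F u
      enlarge-≽ F⊆ = ext grow′ new′ (λ y → proj₁ ∘ ⟪⟫⁻)
        where
        grow′ : ∀ l y → y ∈[ l ] σ → y ∈[ l ] enlarge σ j F u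
        grow′ l y y∈σ with l ≟ᶠ j
        ... | yes refl = subst (y ∈_) (sym enlarge-stem) (∈-++⁺ʳ F y∈σ)
        ... | no l≢j   = subst (y ∈_) (sym (lookup∘update′ l≢j (stem σ) _)) y∈σ

        new′ : ∀ l y → y ∈[ l ] enlarge σ j F u → y ∈[ l ] σ ⊎ (⟦ name σ ⟧ y ≡ true × B l y)
        new′ l y y∈ with l ≟ᶠ j
        ... | no l≢j   = inj₁ (subst (y ∈_) (lookup∘update′ l≢j (stem σ) _) y∈)
        ... | yes refl with ∈-++⁻ F (subst (y ∈_) enlarge-stem y∈)
        ...   | inj₁ y∈F = inj₂ (F⊆ y y∈F)
        ...   | inj₂ y∈σ = inj₁ y∈σ

      enlarge-agrees : ∀ {S} → Compatible (enlarge σ j F u) S → Agree u ⟪ _∈ F ++ lookup (stem σ) j ⟫ (S j)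
      enlarge-agrees compat y y<u = bool-ext
        (λ y∈ → stem⊆ compat j y (subst (y ∈_) (sym enlarge-stem) (⟪⟫⁻ y∈)))
        (λ y∈S → [ (λ y∈ → ⟪⟫⁺ (subst (y ∈_) enlarge-stem y∈))
                 , (λ (y∈X , _) → ⊥-elim (<⇒≱ y<u (proj₂ (⟪⟫⁻ y∈X)))) ]′ (⊆stem compat j y y∈S))

    -- Guarantees that each stem can always grow, which makes every constructed set infinite.
    Saturated : Set
    Saturated = ∀ (σ : State) j b → ∃ λ y → b ≤ y × ⟦ name σ ⟧ y ≡ true × B j y

    dense-infinite : Saturated → ∀ j b σ →
                     Σ State λ τ → σ ≼ τ × (∀ S → Compatible τ S → ∃ λ y → b ≤ y × S j y ≡ true)
    dense-infinite sat j b σ with y , b≤y , y∈X , By ← sat σ j b =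
      enlarge σ j (y ∷ []) 0 , enlarge-≽ σ j (y ∷ []) 0 (λ { _ (here refl) → y∈X , By }) , λ S compat →
        y , b≤y , stem⊆ compat j y (subst (y ∈_) (sym (enlarge-stem σ j (y ∷ []) 0)) (here refl))

    dense-accept : ∀ σ es {j F x} → (∀ y → y ∈ F → ⟦ name σ ⟧ y ≡ true × B j y) →
                   Accepts (stem σ) es j F x →
                   Σ State λ τ → σ ≼ τ × (∀ S → Compatible τ S → Eval (S j) (lookup es j) (x ∷ []) 1)
    dense-accept σ es {j} {F} F⊆ acc with u , use ← Eval-use acc =
      enlarge σ j F u , enlarge-≽ σ j F u F⊆ , λ S compat → use (S j) (enlarge-agrees σ j F u compat)

    -- Some colour class is infinite and becomes the reservoir. Elements of `S j` outside the stem
    -- then have colour `j`, so an accepting computation would use a finite monochromatic set,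
    -- contrary to barrenness.
    dense-barren : ∀ σ es b → ∃ (Barren (stem σ) es ⟦ name σ ⟧ b) →
                   Σ State λ τ → σ ≼ τ × (∀ S → Compatible τ S →
                     ∃ λ j → ∀ x → b ≤ x → ¬ Eval (S j) (lookup es j) (x ∷ []) 1)
    dense-barren σ es b w with c , barren , cell≡ ← cell-spec (stem σ) es w = τ , σ≼τ , rejects
      where
      X = ⟦ name σ ⟧

      big : ∃ λ j → ∀ a → ∃ λ y → a ≤ y × X y ≡ true × c y ≡ j
      big = infinite-pigeonhole _ (λ a≤b (y , b≤y , r) → y , ≤-trans a≤b b≤y , r)
              λ a → let y , a≤y , y∈X = nameInfinite σ a in c y , y , a≤y , y∈X , refl
      j = proj₁ big

      Y : Name
      Y = inj₂ (k , stem σ , es , b , j) ∷ name σ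

      Y⁻ : ∀ y → ⟦ Y ⟧ y ≡ true → X y ≡ true × c y ≡ j
      Y⁻ y y∈Y = ⟪⟫⁻ (trans (sym (cong (λ Z → Z y) (cell≡ j))) y∈Y)

      τ : State
      τ = record
        { stem         = stem σ
        ; name         = Y
        ; name⊆        = λ y y∈Y → name⊆ σ y (proj₁ (Y⁻ y y∈Y))
        ; nameInfinite = λ a → let y , a≤y , r = proj₂ big a in
                         y , a≤y , trans (cong (λ Z → Z y) (cell≡ j)) (⟪⟫⁺ r)
        }

      σ≼τ : σ ≼ τ
      σ≼τ = ext (λ _ _ → id) (λ _ _ → inj₁) (λ y → proj₁ ∘ Y⁻ y)

      rejects : ∀ S → Compatible τ S → ∃ λ j → ∀ x → b ≤ x → ¬ Eval (S j) (lookup es j) (x ∷ []) 1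
      rejects S compat = j , λ x b≤x d →
        let u , use = Eval-use d
            inNew = λ y → em {S j y ≡ true × ⟦ Y ⟧ y ≡ true}
            -- Below the use, `S j` is the stem together with this finite part of the new reservoir.
            F = filter inNew (upTo u)
            F⁻ : ∀ y → y ∈ F → S j y ≡ true × ⟦ Y ⟧ y ≡ true
            F⁻ y y∈F = proj₂ (∈-filter⁻ inNew {xs = upTo u} y∈F)
            agree : Agree u (S j) ⟪ _∈ F ++ lookup (stem σ) j ⟫
            agree y y<u = bool-ext
              (λ y∈S → ⟪⟫⁺ ([ ∈-++⁺ʳ F
                            , (λ (y∈Y , _) → ∈-++⁺ˡ (∈-filter⁺ inNew (∈-upTo⁺ y<u) (y∈S , y∈Y))) ]′
                            (⊆stem compat j y y∈S)))
              (λ y∈ → [ proj₁ ∘ F⁻ y , stem⊆ compat j y ]′ (∈-++⁻ F (⟪⟫⁻ y∈)))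
        in barren j F x b≤x (λ y y∈F → Y⁻ y (proj₂ (F⁻ y y∈F))) (use _ agree)

  -- Seetapun's dichotomy over the generic function

  module Generic (G : ℕ → ℕ) (decides : ∀ i → Decides G (Requirement i)) where

    open Truth G (λ φ ρ → decides (inj₁ (φ , ρ)))

    Holds : ∀ {k} → Vec Formula k → Fin k → ℕ → Set
    Holds φs j y = Sat (fibres G) (y ∷ₑ ρ₀) (lookup φs j)

    Covers : ∀ {k} → Vec Formula k → Subset → Set
    Covers φs X = ∀ y → X y ≡ true → ∃ λ j → Holds φs j y

    -- A prefix of `G` that forces a point to be uncovered would contradict the truth lemma. So `G`
    -- avoids `Uncovers`, which classically says that a colour for each point is densely forced.
    covers⇒densely-forced : ∀ {k} (φs : Vec Formula k) N → Covers φs ⟦ N ⟧ → ∃ λ n →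
      ∀ q → (G ↾ n) ⊑ q → ∀ y → ⟦ N ⟧ y ≡ true → ∃ λ j → Σ (Prefix ℕ) λ r → q ⊑ r × Forces r (y ∷ []) (lookup φs j)
    covers⇒densely-forced φs N cov with decides (inj₂ (inj₁ (_ , φs , N)))
    ... | n , inj₁ (y , y∈N , none) =
      let j , sat = cov y y∈N
          m , f   = Sat⇒Forces (lookup φs j) sat
      in ⊥-elim (none j (G ↾ (n ⊔ m)) (↾-mono (m≤m⊔n n m)) (Forces-mono (lookup φs j) (↾-mono (m≤n⊔m n m)) f))
    ... | n , inj₂ avoid = n , λ q G⊑q y y∈N → by-contradiction λ none →
      avoid q G⊑q (y , y∈N , λ j r q⊑r f → none (j , r , q⊑r , f))

    -- Density is applied to one point at a time; monotonicity of forcing keeps the colours already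
    -- decided.
    force-colouring : ∀ {k} (φs : Vec Formula k) (X : Subset) p →
      (∀ q → p ⊑ q → ∀ y → X y ≡ true → ∃ λ j → Σ (Prefix ℕ) λ r → q ⊑ r × Forces r (y ∷ []) (lookup φs j)) →
      ∀ M → Σ (Prefix ℕ) λ r → p ⊑ r × (∀ y → y < M → X y ≡ true → ∃ λ j → Forces r (y ∷ []) (lookup φs j))
    force-colouring φs X p h zero    = p , ⊑-refl , λ _ ()
    force-colouring φs X p h (suc M)
      with r , p⊑r , col ← force-colouring φs X p h M with em {X M ≡ true}
    ... | no M∉X  = r , p⊑r , col′
      where
      col′ : ∀ y → y < suc M → X y ≡ true → ∃ λ j → Forces r (y ∷ []) (lookup φs j)
      col′ y y<1+M y∈X with m<1+n⇒m<n∨m≡n y<1+M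
      ... | inj₁ y<M  = col y y<M y∈X
      ... | inj₂ refl = ⊥-elim (M∉X y∈X)
    ... | yes M∈X with j , r′ , r⊑r′ , f ← h r p⊑r M M∈X = r′ , ⊑-trans p⊑r r⊑r′ , col′
      where
      col′ : ∀ y → y < suc M → X y ≡ true → ∃ λ j → Forces r′ (y ∷ []) (lookup φs j)
      col′ y y<1+M y∈X with m<1+n⇒m<n∨m≡n y<1+M
      ... | inj₁ y<M  = let l , g = col y y<M y∈X in l , Forces-mono (lookup φs l) r⊑r′ g
      ... | inj₂ refl = j , f

    module _ {k : ℕ} (φs : Vec Formula k) (N : Name) (cov : Covers φs ⟦ N ⟧) where

      open Mathias (Holds φs) N

      Diagonalises : Vec (Code 1) k → ℕ → ℕ → (Fin k → Subset) → Set
      Diagonalises es i b S =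
          (∃₂ λ j a → ∀ x → a ≤ x → ¬ Eval (S j) (lookup es j) (x ∷ []) 1)
        ⊎ (∃₂ λ j x → b ≤ x × G x ≡ i × Eval (S j) (lookup es j) (x ∷ []) 1)

      -- If G met no condition achieving the request, extend it by the constant i
      -- for long enough and let a further extension colour the reservoir: the
      -- colouring would be barren below every bound.
      achieves-or-barren : ∀ σ es i b → (∃ λ n → Achieves φs (stem σ) ⟦ name σ ⟧ es i b (G ↾ n)) ⊎
                           (∃₂ λ a c → Barren (stem σ) es ⟦ name σ ⟧ a c)
      achieves-or-barren σ es i b with decides (inj₂ (inj₂ (k , φs , stem σ , name σ , es , i , b)))
      ... | n , inj₁ ach   = inj₁ (n , ach)
      ... | m , inj₂ avoid = inj₂ (b ⊔ n , barren-compactness (stem σ) es X (b ⊔ n) below)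
        where
        X = ⟦ name σ ⟧
        forced = covers⇒densely-forced φs N cov
        n = m ⊔ proj₁ forced

        -- Colours the points that receive no forced colour. A colour exists because the reservoir
        -- is nonempty and covered.
        default : Fin k
        default = let y , _ , y∈X = nameInfinite σ 0 in proj₁ (cov y (name⊆ σ y y∈X))

        below : ∀ M → ∃ (BarrenBelow (stem σ) es X (b ⊔ n) M)
        below M = c , barren
          where
          q = extendBy i M (G ↾ n)
          G⊑q = extendBy-⊒ i M (G ↾ n)
          coloured = force-colouring φs X q (λ r q⊑r y y∈X →
            proj₂ forced r (⊑-trans (↾-mono (m≤n⊔m m _)) (⊑-trans G⊑q q⊑r)) y (name⊆ σ y y∈X)) M
          r = proj₁ coloured
          q⊑r = proj₁ (proj₂ coloured)

          Colour : ℕ → Set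
          Colour y = ∃ λ j → Forces r (y ∷ []) (lookup φs j)

          pick : ∀ {y} → Dec (Colour y) → Fin k
          pick (yes (j , _)) = j
          pick (no _)        = default

          c : ℕ → Fin k
          c y = pick (em {Colour y})

          c-forced : ∀ {y j} → y < M → X y ≡ true → c y ≡ j → Forces r (y ∷ []) (lookup φs j)
          c-forced {y} y<M y∈X refl with em {Colour y}
          ... | yes (_ , f) = f
          ... | no none     = ⊥-elim (none (proj₂ (proj₂ coloured) y y<M y∈X))

          barren : BarrenBelow (stem σ) es X (b ⊔ n) M c
          barren j F x b⊔n≤x x<M F⊆ acc = avoid r (⊑-trans (↾-mono (m≤m⊔n m _)) (⊑-trans G⊑q q⊑r))
            ( j , F , x , m⊔n≤o⇒m≤o b n b⊔n≤x
            , (<-≤-trans x<q (proj₁ q⊑r)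
              , trans (sym (proj₂ q⊑r x x<q)) (extendBy-new i M (G ↾ n) (m⊔n≤o⇒n≤o b n b⊔n≤x)))
            , (λ y y∈F → let y<M , y∈X , cy≡j = F⊆ y y∈F in y∈X , c-forced y<M y∈X cy≡j)
            , acc )
            where
            x<q : x < len q
            x<q = <-≤-trans x<M (m≤n⊔m n M)

      dense-diagonalises : ∀ es i b σ → Σ State λ τ → σ ≼ τ × (∀ S → Compatible τ S → Diagonalises es i b S)
      dense-diagonalises es i b σ with achieves-or-barren σ es i b
      ... | inj₂ (a , w) =
        let τ , σ≼τ , met = dense-barren σ es a w
        in τ , σ≼τ , λ S compat → let j , rej = met S compat in inj₁ (j , a , rej)
      ... | inj₁ (n , j , F , x , b≤x , (_ , Gx≡i) , F⊆ , acc) =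
        let τ , σ≼τ , met = dense-accept σ es
              (λ y y∈F → let y∈X , f = F⊆ y y∈F in y∈X , Forces⇒Sat (lookup φs j) f) acc
        in τ , σ≼τ , λ S compat → inj₂ (j , x , b≤x , Gx≡i , met S compat)

      Request : Set
      Request = (Fin k × ℕ) ⊎ (Vec (Code 1) k × ℕ × ℕ)

      Request-countable : Request ↣ ℕ
      Request-countable = ⊎-countable (×-countable (Fin-countable k) (↣-id ℕ))
        (×-countable (Vec-countable (Code-countable 1) k) (×-countable (↣-id ℕ) (↣-id ℕ)))

      Meets : Request → (Fin k → Subset) → Set
      Meets (inj₁ (j , b))      S = ∃ λ y → b ≤ y × S j y ≡ true
      Meets (inj₂ (es , i , b)) S = Diagonalises es i b S

      diagonal-sets : Infinite ⟦ N ⟧ → Saturated → Σ (Fin k → Subset) λ S →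
        (∀ j → Infinite (S j)) × (∀ j y → S j y ≡ true → Holds φs j y) × (∀ es i b → Diagonalises es i b S)
      diagonal-sets inf sat with S , compat , met ← meet-all Request-countable Meets
          (λ { (inj₁ (j , b)) → dense-infinite sat j b ; (inj₂ (es , i , b)) → dense-diagonalises es i b })
          (record { stem = replicate k [] ; name = N ; name⊆ = λ _ → id ; nameInfinite = inf }) =
        S , (λ j b → met (inj₁ (j , b))) , holds , λ es i b → met (inj₂ (es , i , b))
        where
        holds : ∀ j y → S j y ≡ true → Holds φs j y
        holds j y y∈S with ⊆stem compat j y y∈S
        ... | inj₂ (_ , sat-y) = sat-y
        ... | inj₁ y∈[] with () ← subst (y ∈_) (lookup-replicate j []) y∈[]

    -- Counting fibres and eliminating colours

    diagonal⇒no-cohesive : ∀ {k} (S : Fin k → Subset) →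
      (∀ es i b → (∃₂ λ j a → ∀ x → a ≤ x → ¬ Eval (S j) (lookup es j) (x ∷ []) 1)
                ⊎ (∃₂ λ j x → b ≤ x × G x ≡ i × Eval (S j) (lookup es j) (x ∷ []) 1)) →
      ∃ λ j → ∀ C → Cohesive (fibres G) C → ¬ Computes (S j) C
    diagonal⇒no-cohesive {k} S diag = by-contradiction λ none →
      let computed : ∀ j → Σ Subset λ C → Cohesive (fibres G) C × Computes (S j) C
          computed j = by-contradiction λ no → none (j , λ C coh cp → no (C , coh , cp))
      in impossible (proj₁ ∘ computed) (proj₁ ∘ proj₂ ∘ computed) (proj₂ ∘ proj₂ ∘ computed)
      where
      impossible : (C : Fin k → Subset) → (∀ j → Cohesive (fibres G) (C j)) →
                   (∀ j → Computes (S j) (C j)) → ⊥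
      impossible C coh cps =
        -- Each of the `k + 1` values `0` to `k` has a colour whose computed set meets that fibre
        -- infinitely often; two values share a colour.
        let i , i′ , i<i′ , same = pigeonhole (n<1+n k) (proj₁ ∘ colour ∘ toℕ)
        in not-cohesive (<ᶠ⇒≢ i<i′ ∘ toℕ-injective) (proj₂ (colour (toℕ i)))
             (subst (λ j → ∀ b → Hit (toℕ i′) j b) (sym same) (proj₂ (colour (toℕ i′)))) (coh _)
        where
        es = tabulate (proj₁ ∘ cps)

        computes : ∀ j x → Eval (S j) (lookup es j) (x ∷ []) (χ (C j) x)
        computes j x = subst (λ e → Eval (S j) e (x ∷ []) (χ (C j) x))
                         (sym (lookup∘tabulate (proj₁ ∘ cps) j)) (proj₂ (cps j) x)

        Hit : ℕ → Fin k → ℕ → Set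
        Hit i j b = ∃ λ x → b ≤ x × G x ≡ i × C j x ≡ true

        hit : ∀ i b → ∃ λ j → Hit i j b
        hit i b with diag es i b
        ... | inj₂ (j , x , b≤x , Gx≡i , d) =
          j , x , b≤x , Gx≡i , χ-1 {C j} (Eval-deterministic (computes j x) d)
        -- A cohesive set is infinite, so it cannot be rejected from `a` on.
        ... | inj₁ (j , a , rejects) with x , a≤x , x∈C ← proj₁ (coh j) a =
          ⊥-elim (rejects x a≤x (subst (Eval (S j) (lookup es j) (x ∷ [])) (χ-true {C j} x∈C) (computes j x)))

        colour : ∀ i → ∃ λ j → ∀ b → Hit i j b
        colour i = infinite-pigeonhole (Hit i)
          (λ a≤b (x , b≤x , r) → x , ≤-trans a≤b b≤x , r) (hit i)

    -- Induction on the number of colours. If saturation fails, a truncated named reservoir misses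
    -- one colour and the other formulas still cover it; with no colours left, an infinite set
    -- cannot be covered.
    cover⇒no-cohesive : ∀ {k} (φs : Vec Formula k) N → Infinite ⟦ N ⟧ → Covers φs ⟦ N ⟧ →
      ∃ λ j → Σ Subset λ S → Infinite S × (∀ y → S y ≡ true → Holds φs j y) ×
                             (∀ C → Cohesive (fibres G) C → ¬ Computes S C)
    cover⇒no-cohesive {zero} φs N inf cov with y , _ , y∈N ← inf 0 with () ← proj₁ (cov y y∈N)
    cover⇒no-cohesive {suc k} φs N inf cov with em {Mathias.Saturated (Holds φs) N}
    ... | yes sat =
      let S , S-inf , S-holds , diag = diagonal-sets φs N cov inf sat
          j , no-cohesive            = diagonal⇒no-cohesive S diag
      in j , S j , S-inf j , S-holds j , no-cohesive
    ... | no ¬sat =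
      let l , S , S-inf , S-holds , no-cohesive =
            cover⇒no-cohesive (removeAt φs j) (inj₁ b ∷ name σ) (truncate-infinite (nameInfinite σ)) cov′
      in punchIn j l , S , S-inf ,
         (λ y y∈S → subst (Sat (fibres G) (y ∷ₑ ρ₀)) (lookup-removeAt φs j l) (S-holds y y∈S)) , no-cohesive
      where
      open Mathias (Holds φs) N
      not-σ = ¬∀⇒∃¬ ¬sat
      σ = proj₁ not-σ
      not-j = ¬∀⇒∃¬ (proj₂ not-σ)
      j = proj₁ not-j
      not-b = ¬∀⇒∃¬ (proj₂ not-j)
      b = proj₁ not-b

      cov′ : Covers (removeAt φs j) ⟦ inj₁ b ∷ name σ ⟧
      cov′ y y∈ with y∈σ , b≤y ← ⟪⟫⁻ y∈ with l , sat-y ← cov y (name⊆ σ y y∈σ) with j ≟ᶠ l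
      ... | yes refl = ⊥-elim (proj₂ not-b (y , b≤y , y∈σ , sat-y))
      ... | no j≢l   = punchOut j≢l ,
        subst (Sat (fibres G) (y ∷ₑ ρ₀)) (sym (removeAt-punchOut φs j≢l)) sat-y

theorem1p5 : ExcludedMiddle 0ℓ →
    Σ SetSeq λ R →
    ∀ (m : ℕ) (A : Fin m → Subset) →
    IsPartition A →
    (∀ j → Arithmetical R (A j)) →
    Σ (Fin m) λ j → Σ Subset λ S →
    Infinite S × S ⊆ A j × (∀ C → Cohesive R C → ¬ Computes S C)
theorem1p5 em = fibres G , λ m A partition arith →
  let φs = tabulate (proj₁ ∘ arith)
      φs≡ = lookup∘tabulate (proj₁ ∘ arith)
      -- The empty name denotes all of `ℕ`, which the classes of the partition cover.
      j , S , S-inf , S-holds , no-cohesive = cover⇒no-cohesive φs [] (λ b → b , ≤-refl , refl) λ y _ →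
        let j , y∈A , _ = partition y
        in j , subst (Sat (fibres G) (y ∷ₑ ρ₀)) (sym (φs≡ j)) (Equivalence.to (proj₂ (arith j) y) y∈A)
  in j , S , S-inf ,
     (λ y y∈S → Equivalence.from (proj₂ (arith j) y)
                  (subst (Sat (fibres G) (y ∷ₑ ρ₀)) (φs≡ j) (S-holds y y∈S))) ,
     no-cohesive
  where
  open Classical em
  G = proj₁ generic
  open Generic G (proj₂ generic)
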